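{- The monic irreducible polynomials over the sign hyperfield $\mathbb S$ are exactly $T$, $T-1$, $T+1$ and $T^2+1$. Consequently every irreducible polynomial over $\mathbb S$ is $\pm$ one of these.
   Context: The sign hyperfield $\mathbb S$ is $\{0,1,-1\}$ with the usual multiplication and hyperaddition $0\boxplus a=\{a\}$, $1\boxplus1=\{1\}$, $(-1)\boxplus(-1)=\{ -1\}$, $1\boxplus(-1)=\{0,1,-1\}$. Iterated sums: $\boxplus_{i=1}^n a_i=\bigcup_{b\in\boxplus_{i=1}^{n-1}a_i} b\boxplus a_n$. A polynomial over $\mathbb S$ is a finitely supported sequence $(c_i)$ in $\mathbb S$, written $\sum c_iT^i$, of degree the largest $k$ with $c_k\ne0$; monic means $c_{\deg p}=1$. Hyperproduct: $p\boxdot q=\{\sum e_iT^i : e_i\in \boxplus_{k+l=i} c_kd_l\}$. $p\sim q$ means $p\in a\boxdot q$ for some $a\in\{\pm1\}$. $p$ is irreducible if $\deg p\ge1$ and $p\in q_1\boxdot q_2$ implies $p\sim q_1$ or $p\sim q_2$. -}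

module Defs where

open import Data.List using (List; []; _∷_; length)
open import Data.Nat using (ℕ; zero; suc; _∸_; _≤_; _<_; s≤s)
open import Data.Product using (∃-syntax; _×_; _,_)
open import Data.Sum using (_⊎_)
open import Level using (0ℓ)
open import Relation.Binary.PropositionalEquality using (_≡_; _≢_; refl; cong)
open import Relation.Unary using (Pred; _∈_; ｛_｝; U)

data 𝕊 : Set where
  0# 1# -1# : 𝕊

infixl 7 _·_
infixl 6 _⊞_
infix  8 -_ -ᵖ_

-_ : 𝕊 → 𝕊
- 0#  = 0#
- 1#  = -1#
- -1# = 1#

_·_ : 𝕊 → 𝕊 → 𝕊
0#  · _ = 0#
1#  · a = a
-1# · a = - a

_⊞_ : 𝕊 → 𝕊 → Pred 𝕊 0ℓ
0#  ⊞ a   = ｛ a ｝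
1#  ⊞ 0#  = ｛ 1# ｝
1#  ⊞ 1#  = ｛ 1# ｝
1#  ⊞ -1# = U
-1# ⊞ 0#  = ｛ -1# ｝
-1# ⊞ 1#  = U
-1# ⊞ -1# = ｛ -1# ｝

-- ⊞[0⋯ n ] a is the iterated hypersum of the n + 1 terms a 0, …, a n.
⊞[0⋯_] : ℕ → (ℕ → 𝕊) → Pred 𝕊 0ℓ
⊞[0⋯ zero  ] a   = ｛ a 0 ｝
⊞[0⋯ suc n ] a x = ∃[ b ] (b ∈ ⊞[0⋯ n ] a × x ∈ b ⊞ a (suc n))

record Poly : Set where
  constructor mkPoly
  field
    coeff         : ℕ → 𝕊
    finiteSupport : ∃[ N ] (∀ i → N ≤ i → coeff i ≡ 0#)

open Poly public

-- Equality of polynomials is equality of coefficient sequences, independent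
-- of the chosen bound on the support.
infix 4 _≈_
_≈_ : Poly → Poly → Set
p ≈ q = ∀ i → coeff p i ≡ coeff q i

-ᵖ_ : Poly → Poly
-ᵖ mkPoly c (N , z) = mkPoly (λ i → - c i) (N , λ i N≤i → cong -_ (z i N≤i))

coeffs : List 𝕊 → ℕ → 𝕊
coeffs []       _       = 0#
coeffs (a ∷ _)  zero    = a
coeffs (_ ∷ as) (suc i) = coeffs as i

coeffs-vanish : ∀ as i → length as ≤ i → coeffs as i ≡ 0#
coeffs-vanish []       _       _         = refl
coeffs-vanish (_ ∷ as) (suc i) (s≤s l≤i) = coeffs-vanish as i l≤i

-- Coefficients are listed from the constant term upwards.
fromList : List 𝕊 → Poly
fromList as = mkPoly (coeffs as) (length as , coeffs-vanish as)

const : 𝕊 → Poly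
const a = fromList (a ∷ [])

T T-1 T+1 T²+1 : Poly
T    = fromList (0# ∷ 1# ∷ [])
T-1  = fromList (-1# ∷ 1# ∷ [])
T+1  = fromList (1# ∷ 1# ∷ [])
T²+1 = fromList (1# ∷ 0# ∷ 1# ∷ [])

-- A relation rather than a function, since the zero polynomial has no degree.
HasDegree : Poly → ℕ → Set
HasDegree p n = coeff p n ≢ 0# × (∀ i → n < i → coeff p i ≡ 0#)

Monic : Poly → Set
Monic p = ∃[ n ] (HasDegree p n × coeff p n ≡ 1#)

infixl 7 _⊡_
_⊡_ : Poly → Poly → Pred Poly 0ℓ
(p ⊡ q) e = ∀ i → coeff e i ∈ ⊞[0⋯ i ] (λ k → coeff p k · coeff q (i ∸ k))

infix 4 _∼_
_∼_ : Poly → Poly → Set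
p ∼ q = ∃[ a ] ((a ≡ 1# ⊎ a ≡ -1#) × p ∈ const a ⊡ q)

Irreducible : Poly → Set
Irreducible p =
  (∃[ n ] (HasDegree p n × 1 ≤ n)) ×
  (∀ q₁ q₂ → p ∈ q₁ ⊡ q₂ → p ∼ q₁ ⊎ p ∼ q₂)

{-# OPTIONS --safe #-}

-- Every polynomial p of degree n ≥ 2 other than ±(T² + 1) has a factorization
-- into factors of smaller degree.  If p₀ = 0, split off T.  Otherwise pₙ = ±p₀,
-- and since 1 ⊞ -1 is everything, a factor with suitable signs makes all inner
-- coefficients of the product arbitrary, so only p₀ and pₙ have to be matched:
--   pₙ = -p₀            (T - 1) (c + c T + ⋯ + c Tⁿ⁻¹)
--   pₙ = p₀, n odd      (T + 1) (c - c T + ⋯ + c Tⁿ⁻¹)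
--   pₙ = p₀, n ≥ 4 even (T² + T + 1) (c - c T + ⋯ + c Tⁿ⁻²)
-- while c T² + b T + c with b ≠ 0 is (T + c b) (c T + b).
module Submission where

open import Data.List using ([]; _∷_)
open import Data.List.Relation.Unary.Any using (Any; here; there)
open import Data.Nat using (ℕ; zero; suc; _+_; _∸_; _≤_; _<_; z≤n; s≤s; _≤?_)
open import Data.Nat.GeneralisedArithmetic using (fold)
open import Data.Nat.Properties
open import Data.Product using (∃-syntax; _×_; _,_; proj₁; proj₂)
open import Data.Sum using (_⊎_; inj₁; inj₂)
open import Data.Unit using (tt)
open import Function.Base using (_∘_)
open import Function.Bundles using (_⇔_; mk⇔)
open import Relation.Binary.Definitions using (tri<; tri≈; tri>)
open import Relation.Binary.PropositionalEquality
open import Relation.Nullary using (¬_; Dec; yes; no; contradiction)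
open import Relation.Unary using (_∈_)
open import Defs

-- Signs

infix 4 _≟0#
_≟0# : ∀ a → Dec (a ≡ 0#)
0#  ≟0# = yes refl
1#  ≟0# = no λ ()
-1# ≟0# = no λ ()

≢0⇒±1 : ∀ {a} → a ≢ 0# → a ≡ 1# ⊎ a ≡ -1#
≢0⇒±1 {0#}  a≢0 = contradiction refl a≢0
≢0⇒±1 {1#}  _   = inj₁ refl
≢0⇒±1 { -1#} _  = inj₂ refl

equal-or-opposite : ∀ {a b} → a ≢ 0# → b ≢ 0# → a ≡ b ⊎ a ≡ - b
equal-or-opposite a≢0 b≢0 with ≢0⇒±1 a≢0 | ≢0⇒±1 b≢0
... | inj₁ refl | inj₁ refl = inj₁ refl
... | inj₁ refl | inj₂ refl = inj₂ refl
... | inj₂ refl | inj₁ refl = inj₂ refl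
... | inj₂ refl | inj₂ refl = inj₁ refl

-‿involutive : ∀ a → - (- a) ≡ a
-‿involutive 0#  = refl
-‿involutive 1#  = refl
-‿involutive -1# = refl

-‿nonzero : ∀ {a} → a ≢ 0# → - a ≢ 0#
-‿nonzero {0#}  a≢0 _ = a≢0 refl
-‿nonzero {1#}  _ ()
-‿nonzero { -1#} _ ()

·-zeroʳ : ∀ a → a · 0# ≡ 0#
·-zeroʳ 0#  = refl
·-zeroʳ 1#  = refl
·-zeroʳ -1# = refl

·-zeroʳ-≡ : ∀ a {b} → b ≡ 0# → a · b ≡ 0#
·-zeroʳ-≡ a refl = ·-zeroʳ a

·-comm : ∀ a b → a · b ≡ b · a
·-comm 0#  b   = sym (·-zeroʳ b)
·-comm 1#  0#  = refl
·-comm 1#  1#  = refl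
·-comm 1#  -1# = refl
·-comm -1# 0#  = refl
·-comm -1# 1#  = refl
·-comm -1# -1# = refl

·-nonzero : ∀ {a b} → a ≢ 0# → b ≢ 0# → a · b ≢ 0#
·-nonzero {0#}  a≢0 _   = contradiction refl a≢0
·-nonzero {1#}  _   b≢0 = b≢0
·-nonzero { -1#} _  b≢0 = -‿nonzero b≢0

·≡1⇒≡ : ∀ a b → a · b ≡ 1# → a ≡ b × a ≢ 0#
·≡1⇒≡ 1#  1#  _ = refl , λ ()
·≡1⇒≡ -1# -1# _ = refl , λ ()

-- Hypersums

⊞-identityʳ⁺ : ∀ a → a ∈ a ⊞ 0#
⊞-identityʳ⁺ 0#  = refl
⊞-identityʳ⁺ 1#  = refl
⊞-identityʳ⁺ -1# = refl

⊞-identityʳ⁻ : ∀ {x} a → x ∈ a ⊞ 0# → x ≡ a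
⊞-identityʳ⁻ 0#  refl = refl
⊞-identityʳ⁻ 1#  refl = refl
⊞-identityʳ⁻ -1# refl = refl

-- The source of all freedom in the factorizations: two opposite terms leave a coefficient of the
-- product unconstrained.
⊞-inverse-full : ∀ {a} x → a ≢ 0# → x ∈ - a ⊞ a
⊞-inverse-full {0#}  _ a≢0 = contradiction refl a≢0
⊞-inverse-full {1#}  _ _   = tt
⊞-inverse-full { -1#} _ _  = tt

-- Trailing zero terms can be appended since `x ∈ x ⊞ 0#`. A factor of fixed low degree thus needs
-- only its first few terms in each coefficient of a product.
⊞-extend : ∀ {m n a x} → m ≤ n → (∀ k → m < k → a k ≡ 0#) →
           x ∈ ⊞[0⋯ m ] a → x ∈ ⊞[0⋯ n ] a
⊞-extend {m} {n} {a} {x} m≤n a≡0 x∈ with m≤n⇒m<n∨m≡n m≤n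
... | inj₂ refl = x∈
⊞-extend {m} {suc n} {a} {x} _ a≡0 x∈ | inj₁ (s≤s m≤n) =
  x , ⊞-extend m≤n a≡0 x∈ ,
  subst (λ y → x ∈ x ⊞ y) (sym (a≡0 (suc n) (s≤s m≤n))) (⊞-identityʳ⁺ x)

⊞-zeros : ∀ n {a x} → (∀ k → k ≤ n → a k ≡ 0#) → x ∈ ⊞[0⋯ n ] a → x ≡ 0#
⊞-zeros zero    a≡0 refl = a≡0 0 z≤n
⊞-zeros (suc n) a≡0 (b , b∈ , x∈)
  rewrite a≡0 (suc n) ≤-refl
        | ⊞-zeros n (λ k k≤n → a≡0 k (m≤n⇒m≤1+n k≤n)) b∈ = sym x∈

-- Hyperaddition is single-valued as long as one summand is `0#`. Leading coefficients and products
-- with constants are therefore determined.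
⊞-single : ∀ {m} n {a x} → m ≤ n → (∀ k → k ≤ n → k ≢ m → a k ≡ 0#) →
           x ∈ ⊞[0⋯ n ] a → x ≡ a m
⊞-single zero z≤n _ refl = refl
⊞-single {m} (suc n) m≤n a≡0 (b , b∈ , x∈) with m≤n⇒m<n∨m≡n m≤n
... | inj₂ refl
  rewrite ⊞-zeros n (λ k k≤n → a≡0 k (m≤n⇒m≤1+n k≤n) (<⇒≢ (s≤s k≤n))) b∈ = sym x∈
... | inj₁ (s≤s m≤n′)
  rewrite a≡0 (suc n) ≤-refl (<⇒≢ (s≤s m≤n′) ∘ sym) =
  trans (⊞-identityʳ⁻ b x∈) (⊞-single n m≤n′ (λ k k≤n → a≡0 k (m≤n⇒m≤1+n k≤n)) b∈)

-- Degrees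

HasDegree-unique : ∀ {p m n} → HasDegree p m → HasDegree p n → m ≡ n
HasDegree-unique {_} {m} {n} (pm , p>m) (pn , p>n) with <-cmp m n
... | tri< m<n _ _ = contradiction (p>m n m<n) pn
... | tri≈ _ m≡n _ = m≡n
... | tri> _ _ n<m = contradiction (p>n m n<m) pm

HasDegree-resp-≈ : ∀ {p q n} → p ≈ q → HasDegree q n → HasDegree p n
HasDegree-resp-≈ p≈q (qn , q>n) =
  qn ∘ trans (sym (p≈q _)) , λ i n<i → trans (p≈q i) (q>n i n<i)

zero-or-degree : ∀ p → (∀ i → coeff p i ≡ 0#) ⊎ ∃[ n ] HasDegree p n
zero-or-degree (mkPoly c (N , c≡0)) = search N c≡0
  where
  search : ∀ N → (∀ i → N ≤ i → c i ≡ 0#) →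
           (∀ i → c i ≡ 0#) ⊎
           ∃[ n ] (c n ≢ 0# × (∀ i → n < i → c i ≡ 0#))
  search zero    c≡0 = inj₁ λ i → c≡0 i z≤n
  search (suc N) c≡0 with c N ≟0#
  ... | no cN≢0  = inj₂ (N , cN≢0 , c≡0)
  ... | yes cN≡0 = search N λ i N≤i → case i N≤i
    where
    case : ∀ i → N ≤ i → c i ≡ 0#
    case i N≤i with m≤n⇒m<n∨m≡n N≤i
    ... | inj₁ N<i  = c≡0 i N<i
    ... | inj₂ refl = cN≡0

-- Only the term `k = m` survives: a smaller `k` pushes the index into `q` above `n`, a larger one
-- exceeds the degree of `p`.
⊡-leading : ∀ p q {e m n} → HasDegree p m → HasDegree q n → e ∈ p ⊡ q →
            coeff e (m + n) ≡ coeff p m · coeff q n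
⊡-leading p q {e} {m} {n} (_ , p>m) (_ , q>n) e∈ =
  trans (⊞-single (m + n) (m≤m+n m n) others (e∈ (m + n)))
        (cong (λ j → coeff p m · coeff q j) (m+n∸m≡n m n))
  where
  others : ∀ k → k ≤ m + n → k ≢ m → coeff p k · coeff q (m + n ∸ k) ≡ 0#
  others k _ k≢m with <-cmp k m
  ... | tri< k<m _ _ = ·-zeroʳ-≡ (coeff p k) (q>n _
          (subst (_< m + n ∸ k) (m+n∸m≡n m n) (∸-monoʳ-< k<m (m≤m+n m n))))
  ... | tri≈ _ k≡m _ = contradiction k≡m k≢m
  ... | tri> _ _ m<k rewrite p>m k m<k = refl

⊡-degree : ∀ p q {e m n} → HasDegree p m → HasDegree q n → e ∈ p ⊡ q →
           HasDegree e (m + n)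
⊡-degree p q {e} {m} {n} dp@(pm , p>m) dq@(qn , q>n) e∈ =
  ·-nonzero pm qn ∘ trans (sym (⊡-leading p q {e} dp dq e∈)) ,
  λ i m+n<i → ⊞-zeros i (λ k _ → term i m+n<i k) (e∈ i)
  where
  term : ∀ i → m + n < i → ∀ k → coeff p k · coeff q (i ∸ k) ≡ 0#
  term i m+n<i k with k ≤? m
  ... | no k≰m rewrite p>m k (≰⇒> k≰m) = refl
  -- From `k ≤ m` and `m + n < i` follows `n < i ∸ k`, beyond the degree of `q`.
  ... | yes k≤m = ·-zeroʳ-≡ (coeff p k) (q>n _
          (m+n≤o⇒m≤o∸n (suc n)
            (≤-trans (≤-reflexive (cong suc (+-comm n k)))
                     (≤-trans (s≤s (+-monoˡ-≤ n k≤m)) m+n<i))))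

-- Associates and scalar factors

const-⊡⁺ : ∀ {p} a q → (∀ i → coeff p i ≡ a · coeff q i) → p ∈ const a ⊡ q
const-⊡⁺ a q p≡ i = ⊞-extend z≤n (λ { (suc k) _ → refl }) (sym (p≡ i))

⊡-constˡ : ∀ q₁ {q₂ p} → HasDegree q₁ 0 → p ∈ q₁ ⊡ q₂ →
           ∀ i → coeff p i ≡ coeff q₁ 0 · coeff q₂ i
⊡-constˡ q₁ (_ , q₁>0) p∈ i = ⊞-single i z≤n others (p∈ i)
  where
  others : ∀ k → k ≤ i → k ≢ 0 → coeff q₁ k · _ ≡ 0#
  others k _ k≢0 rewrite q₁>0 k (n≢0⇒n>0 k≢0) = refl

⊡-constʳ : ∀ q₁ q₂ {p} → HasDegree q₂ 0 → p ∈ q₁ ⊡ q₂ →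
           ∀ i → coeff p i ≡ coeff q₁ i · coeff q₂ 0
⊡-constʳ q₁ q₂ (_ , q₂>0) p∈ i =
  trans (⊞-single i ≤-refl others (p∈ i))
        (cong (λ j → coeff q₁ i · coeff q₂ j) (n∸n≡0 i))
  where
  others : ∀ k → k ≤ i → k ≢ i → coeff q₁ k · coeff q₂ (i ∸ k) ≡ 0#
  others k k≤i k≢i = ·-zeroʳ-≡ (coeff q₁ k) (q₂>0 _ (m<n⇒0<n∸m (≤∧≢⇒< k≤i k≢i)))

∼⇒vanish : ∀ {p} q n → p ∼ q → coeff q n ≡ 0# → coeff p n ≡ 0#
∼⇒vanish {p} q n (a , a≡±1 , p∈) qn≡0 =
  trans (⊡-constˡ (const a) {q} {p} (nonzero a≡±1 , λ { (suc i) _ → refl }) p∈ n)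
        (·-zeroʳ-≡ a qn≡0)
  where
  nonzero : a ≡ 1# ⊎ a ≡ -1# → a ≢ 0#
  nonzero (inj₁ refl) ()
  nonzero (inj₂ refl) ()

-- Irreducibility of linear polynomials and of `T²+1`

factor-degrees : ∀ {p n} q₁ q₂ → HasDegree p n → p ∈ q₁ ⊡ q₂ →
  ∃[ d₁ ] ∃[ d₂ ] (HasDegree q₁ d₁ × HasDegree q₂ d₂ × n ≡ d₁ + d₂)
factor-degrees {p} {n} q₁ q₂ dp p∈ with zero-or-degree q₁ | zero-or-degree q₂
... | inj₁ q₁≡0 | _ =
  -- A zero factor would make the leading coefficient of `p` a hypersum of zeros.
  contradiction (⊞-zeros n (λ k _ → cong (_· _) (q₁≡0 k)) (p∈ n)) (proj₁ dp)
... | inj₂ _ | inj₁ q₂≡0 =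
  contradiction (⊞-zeros n (λ k _ → ·-zeroʳ-≡ (coeff q₁ k) (q₂≡0 (n ∸ k))) (p∈ n)) (proj₁ dp)
... | inj₂ (d₁ , dq₁) | inj₂ (d₂ , dq₂) =
  d₁ , d₂ , dq₁ , dq₂ , HasDegree-unique {p} dp (⊡-degree q₁ q₂ {p} dq₁ dq₂ p∈)

-- A factor of degree 0 is a sign, which makes `p` an associate of the other factor. Only
-- factorizations into two factors of positive degree remain to be excluded.
irreducible-intro : ∀ p {n} → HasDegree p n → 1 ≤ n →
  (∀ q₁ q₂ m₁ m₂ → HasDegree q₁ (suc m₁) → HasDegree q₂ (suc m₂) →
     n ≡ suc m₁ + suc m₂ → ¬ p ∈ q₁ ⊡ q₂) →
  Irreducible p
irreducible-intro p {n} dp 1≤n no-proper = (n , dp , 1≤n) , split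
  where
  split : ∀ q₁ q₂ → p ∈ q₁ ⊡ q₂ → p ∼ q₁ ⊎ p ∼ q₂
  split q₁ q₂ p∈ with factor-degrees {p} q₁ q₂ dp p∈
  ... | zero , _ , dq₁ , _ , _ =
    inj₂ (coeff q₁ 0 , ≢0⇒±1 (proj₁ dq₁) ,
          const-⊡⁺ {p} (coeff q₁ 0) q₂ (⊡-constˡ q₁ {q₂} {p} dq₁ p∈))
  ... | suc _ , zero , _ , dq₂ , _ =
    inj₁ (coeff q₂ 0 , ≢0⇒±1 (proj₁ dq₂) ,
          const-⊡⁺ {p} (coeff q₂ 0) q₁ λ i →
            trans (⊡-constʳ q₁ q₂ {p} dq₂ p∈ i) (·-comm (coeff q₁ i) (coeff q₂ 0)))
  ... | suc m₁ , suc m₂ , dq₁ , dq₂ , n≡ =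
    contradiction p∈ (no-proper q₁ q₂ m₁ m₂ dq₁ dq₂ n≡)

degree-1-irreducible : ∀ p → HasDegree p 1 → Irreducible p
degree-1-irreducible p dp = irreducible-intro p dp ≤-refl
  λ _ _ m₁ m₂ _ _ 1≡ _ → contradiction (trans 1≡ (cong suc (+-suc m₁ m₂))) λ ()

T²+1-degree : HasDegree T²+1 2
T²+1-degree = (λ ()) , coeffs-vanish _

-- The outer coefficients force two linear factors to have the same constant term `a` and the same
-- leading coefficient `b`. The middle coefficient then lies in `a · b ⊞ b · a`, a sum of two equal
-- nonzero signs, which omits `0#`.
≈T²+1-irreducible : ∀ p → p ≈ T²+1 → Irreducible p
≈T²+1-irreducible p p≈ = irreducible-intro p dp (s≤s z≤n) no-proper
  where
  dp : HasDegree p 2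
  dp = HasDegree-resp-≈ {p} {T²+1} p≈ T²+1-degree

  cross≢0 : ∀ {a b} → a ≢ 0# → b ≢ 0# → ¬ 0# ∈ a · b ⊞ b · a
  cross≢0 a≢0 b≢0 0∈ with ≢0⇒±1 a≢0 | ≢0⇒±1 b≢0
  cross≢0 _ _ () | inj₁ refl | inj₁ refl
  cross≢0 _ _ () | inj₁ refl | inj₂ refl
  cross≢0 _ _ () | inj₂ refl | inj₁ refl
  cross≢0 _ _ () | inj₂ refl | inj₂ refl

  no-proper : ∀ q₁ q₂ m₁ m₂ → HasDegree q₁ (suc m₁) → HasDegree q₂ (suc m₂) →
              2 ≡ suc m₁ + suc m₂ → ¬ p ∈ q₁ ⊡ q₂
  no-proper q₁ q₂ zero zero dq₁ dq₂ refl p∈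
    with ·≡1⇒≡ (coeff q₁ 0) (coeff q₂ 0) (trans (p∈ 0) (p≈ 0))
       | ·≡1⇒≡ (coeff q₁ 1) (coeff q₂ 1) (trans (sym (⊡-leading q₁ q₂ {p} dq₁ dq₂ p∈)) (p≈ 2))
  ... | q₁0≡q₂0 , q₁0≢0 | q₁1≡q₂1 , q₁1≢0 with p∈ 1
  ... | _ , refl , p1∈ rewrite p≈ 1 | sym q₁0≡q₂0 | sym q₁1≡q₂1 =
    cross≢0 q₁0≢0 q₁1≢0 p1∈
  no-proper _ _ zero    (suc m₂) _ _ ()
  no-proper _ _ (suc m₁) m₂      _ _ 2≡ =
    contradiction (trans 2≡ (cong (2 +_) (+-suc m₁ m₂))) λ ()

-- Factorizations

-- At `0#`, `-1#` and `1#` this unfolds to `T`, `T-1` and `T+1`, so one lemma serves all three.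
linear : 𝕊 → Poly
linear a = fromList (a ∷ 1# ∷ [])

linear-⊡ : ∀ {p} a q → a · coeff q 0 ≡ coeff p 0 →
           (∀ i → coeff p (suc i) ∈ a · coeff q (suc i) ⊞ coeff q i) →
           p ∈ linear a ⊡ q
linear-⊡ a q p0 _     zero    = p0
linear-⊡ a q _  p-suc (suc i) =
  ⊞-extend (s≤s z≤n) (λ { (suc (suc k)) _ → refl ; (suc zero) (s≤s ()) })
    (_ , refl , p-suc i)

T²+T+1 : Poly
T²+T+1 = fromList (1# ∷ 1# ∷ 1# ∷ [])

T²+T+1-⊡ : ∀ {p} q → coeff q 0 ≡ coeff p 0 →
  coeff p 1 ∈ coeff q 1 ⊞ coeff q 0 →
  (∀ i → ∃[ b ] (b ∈ coeff q (2 + i) ⊞ coeff q (1 + i) ×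
                 coeff p (2 + i) ∈ b ⊞ coeff q i)) →
  p ∈ T²+T+1 ⊡ q
T²+T+1-⊡ q p0 _  _   zero          = p0
T²+T+1-⊡ q _  p1 _   (suc zero)    = _ , refl , p1
T²+T+1-⊡ q _  _  p2+ (suc (suc i)) with p2+ i
... | b , b∈ , p∈ =
  ⊞-extend (s≤s (s≤s z≤n))
    (λ { (suc (suc (suc k))) _ → refl ; (suc (suc zero)) (s≤s (s≤s ())) ; (suc zero) (s≤s ()) })
    (b , (_ , refl , b∈) , p∈)

-- Cofactors with a prescribed sign pattern

truncate : ℕ → (ℕ → 𝕊) → ℕ → 𝕊
truncate d f i with i ≤? d
... | yes _ = f i
... | no  _ = 0#

truncate-≤ : ∀ {d i} f → i ≤ d → truncate d f i ≡ f i
truncate-≤ {d} {i} f i≤d with i ≤? d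
... | yes _  = refl
... | no i≰d = contradiction i≤d i≰d

truncate-> : ∀ {d i} f → d < i → truncate d f i ≡ 0#
truncate-> {d} {i} f d<i with i ≤? d
... | yes i≤d = contradiction d<i (≤⇒≯ i≤d)
... | no _    = refl

-- The pattern `f` lives on all of `ℕ`, so its recursion has no boundary case; the cut at `d` is
-- handled separately.
truncated : ℕ → (ℕ → 𝕊) → Poly
truncated d f = mkPoly (truncate d f) (suc d , λ i → truncate-> f)

-- For `i < d` the sum for coefficient `suc i` is `- f i ⊞ f i`, which is everything. At `i = d`
-- only `f d` is left, and beyond it both terms vanish.
linear-⊡-truncated : ∀ {p} a f d → HasDegree p (suc d) →
  (∀ i → f i ≢ 0#) → (∀ i → a · f (suc i) ≡ - f i) →
  a · f 0 ≡ coeff p 0 → f d ≡ coeff p (suc d) →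
  p ∈ linear a ⊡ truncated d f
linear-⊡-truncated {p} a f d (_ , p>) f≢0 step p0 pd =
  linear-⊡ {p} a (truncated d f)
    (trans (cong (a ·_) (truncate-≤ {d} f z≤n)) p0) p-suc
  where
  p-suc : ∀ i → coeff p (suc i) ∈ a · truncate d f (suc i) ⊞ truncate d f i
  p-suc i with <-cmp i d
  ... | tri< i<d _ _ rewrite truncate-≤ f i<d | truncate-≤ f (<⇒≤ i<d) | step i =
    ⊞-inverse-full (coeff p (suc i)) (f≢0 i)
  ... | tri≈ _ refl _ rewrite truncate-> f (≤-refl {suc i}) | truncate-≤ f (≤-refl {i})
                            | ·-zeroʳ a = pd
  ... | tri> _ _ d<i rewrite truncate-> f (m≤n⇒m≤1+n d<i) | truncate-> f d<i
                           | ·-zeroʳ a = sym (p> (suc i) (s≤s d<i))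

alternating : 𝕊 → ℕ → 𝕊
alternating c = fold c -_

alternating-nonzero : ∀ {c} → c ≢ 0# → ∀ i → alternating c i ≢ 0#
alternating-nonzero c≢0 zero    = c≢0
alternating-nonzero c≢0 (suc i) = -‿nonzero (alternating-nonzero c≢0 i)

T²+T+1-⊡-alternating : ∀ {p} c m → HasDegree p (3 + m) → c ≢ 0# →
  c ≡ coeff p 0 → alternating c (suc m) ≡ coeff p (3 + m) →
  p ∈ T²+T+1 ⊡ truncated (suc m) (alternating c)
T²+T+1-⊡-alternating {p} c m (_ , p>) c≢0 p0 pd =
  T²+T+1-⊡ {p} (truncated d f) (trans (truncate-≤ {d} f z≤n) p0) p1 p2+
  where
  d = suc m
  f = alternating c
  f≢0 = alternating-nonzero c≢0

  p1 : coeff p 1 ∈ truncate d f 1 ⊞ truncate d f 0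
  p1 rewrite truncate-≤ f (s≤s (z≤n {m})) | truncate-≤ {d} f z≤n =
    ⊞-inverse-full (coeff p 1) c≢0

  p2+ : ∀ i → ∃[ b ] (b ∈ truncate d f (2 + i) ⊞ truncate d f (1 + i) ×
                      coeff p (2 + i) ∈ b ⊞ truncate d f i)
  p2+ i with <-cmp i m
  ... | tri< i<m _ _
    rewrite truncate-≤ f (s≤s i<m) | truncate-≤ f (s≤s (<⇒≤ i<m))
          | truncate-≤ {d} f (m≤n⇒m≤1+n (<⇒≤ i<m)) =
    -- The first two terms are opposite, so their sum may be chosen as `- f i`; adding `f i` then
    -- reaches every sign.
    - f i , ⊞-inverse-full (- f i) (f≢0 (suc i)) ,
    ⊞-inverse-full (coeff p (2 + i)) (f≢0 i)
  ... | tri≈ _ refl _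
    rewrite truncate-> f (≤-refl {2 + i}) | truncate-≤ f (≤-refl {suc i})
          | truncate-≤ {d} f (n≤1+n i) =
    -- Here the first term is cut off and the second, `f (suc i)`, is already `- f i`.
    - f i , refl , ⊞-inverse-full (coeff p (2 + i)) (f≢0 i)
  ... | tri> _ _ m<i with m≤n⇒m<n∨m≡n m<i
  ...   | inj₂ refl
    rewrite truncate-> f (m≤n⇒m≤1+n (≤-refl {2 + m})) | truncate-> f (≤-refl {2 + m})
          -- At `i = suc m` only the last coefficient of the cofactor contributes, giving the
          -- leading coefficient of `p`.
          | truncate-≤ f (≤-refl {suc m}) = 0# , refl , pd
  ...   | inj₁ d<i
    rewrite truncate-> f (m≤n⇒m≤1+n (m≤n⇒m≤1+n d<i)) | truncate-> f (m≤n⇒m≤1+n d<i)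
          | truncate-> f d<i = 0# , refl , sym (p> (2 + i) (s≤s (s≤s d<i)))

-- Classification

-- An associate of a factor vanishes wherever the factor does, whereas `p` does not vanish at `n`.
-- Looking at this one coefficient avoids computing the degrees of the factors.
proper-factorization⇒reducible : ∀ p {n} q₁ q₂ → HasDegree p n →
  p ∈ q₁ ⊡ q₂ → coeff q₁ n ≡ 0# → coeff q₂ n ≡ 0# → ¬ Irreducible p
proper-factorization⇒reducible p {n} q₁ q₂ (pn≢0 , _) p∈ q₁n≡0 q₂n≡0 (_ , irr)
  with irr q₁ q₂ p∈
... | inj₁ p∼q₁ = pn≢0 (∼⇒vanish {p} q₁ n p∼q₁ q₁n≡0)
... | inj₂ p∼q₂ = pn≢0 (∼⇒vanish {p} q₂ n p∼q₂ q₂n≡0)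

zero-constant-reducible : ∀ p {m} → HasDegree p (2 + m) → coeff p 0 ≡ 0# → ¬ Irreducible p
zero-constant-reducible p@(mkPoly c (N , c≡0)) dp p0≡0 =
  proper-factorization⇒reducible p (linear 0#) shift dp
    -- Coefficient `2 + m` of `shift` is coefficient `3 + m` of `p`, just above its degree.
    (linear-⊡ {p} 0# shift (sym p0≡0) (λ _ → refl)) refl (proj₂ dp _ ≤-refl)
  where
  shift : Poly
  shift = mkPoly (c ∘ suc) (N , λ i N≤i → c≡0 (suc i) (m≤n⇒m≤1+n N≤i))

opposite-ends-reducible : ∀ p {m} → HasDegree p (2 + m) →
  coeff p (2 + m) ≡ - coeff p 0 → ¬ Irreducible p
opposite-ends-reducible p {m} dp pn≡ =
  proper-factorization⇒reducible p (linear -1#) (truncated (suc m) f) dp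
    -- A constant pattern suits `linear -1#`, since multiplying by `-1#` already supplies the
    -- opposite sign.
    (linear-⊡-truncated {p} -1# f (suc m) dp (λ _ → proj₁ dp) (λ _ → refl)
      (trans (cong -_ pn≡) (-‿involutive (coeff p 0))) refl)
    refl (truncate-> {suc m} f ≤-refl)
  where
  f : ℕ → 𝕊
  f _ = coeff p (2 + m)

-- The parity of the degree enters as the sign of the last alternating coefficient.
equal-ends-reducible : ∀ p {m} → HasDegree p (3 + m) → coeff p 0 ≢ 0# →
  coeff p (3 + m) ≡ coeff p 0 → ¬ Irreducible p
equal-ends-reducible p {m} dp p0≢0 pn≡
  with equal-or-opposite (alternating-nonzero p0≢0 (2 + m)) p0≢0
... | inj₁ last≡ =
  proper-factorization⇒reducible p (linear 1#) (truncated (2 + m) f) dp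
    (linear-⊡-truncated {p} 1# f (2 + m) dp (alternating-nonzero p0≢0) (λ _ → refl)
      refl (trans last≡ (sym pn≡)))
    refl (truncate-> {2 + m} f ≤-refl)
  where f = alternating (coeff p 0)
... | inj₂ last≡ =
  proper-factorization⇒reducible p T²+T+1 (truncated (1 + m) f) dp
    (T²+T+1-⊡-alternating {p} (coeff p 0) m dp p0≢0 refl
      -- By definition `last≡` says `- f (1 + m) ≡ - coeff p 0`; negating both sides gives the last
      -- coefficient of the cofactor.
      (trans (trans (sym (-‿involutive (f (1 + m)))) (trans (cong -_ last≡) (-‿involutive _)))
             (sym pn≡)))
    refl (truncate-> {1 + m} f (n≤1+n (2 + m)))
  where f = alternating (coeff p 0)

-- Nonzero signs square to `1#`, so the product has constant term `c · b · b ≡ c`, and its middle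
-- coefficient lies in `b ⊞ b`, which is only `b`.
palindromic-quadratic-reducible : ∀ p → HasDegree p 2 → coeff p 1 ≢ 0# →
  coeff p 2 ≡ coeff p 0 → ¬ Irreducible p
palindromic-quadratic-reducible p dp p1≢0 p2≡p0 =
  proper-factorization⇒reducible p (linear (c · b)) (fromList (b ∷ c ∷ [])) dp
    (linear-⊡ {p} (c · b) (fromList (b ∷ c ∷ []))
      (trans (outer (proj₁ dp) p1≢0) p2≡p0) p-suc)
    refl refl
  where
  b = coeff p 1
  c = coeff p 2

  outer : ∀ {c b} → c ≢ 0# → b ≢ 0# → c · b · b ≡ c
  outer c≢0 b≢0 with ≢0⇒±1 c≢0 | ≢0⇒±1 b≢0
  ... | inj₁ refl | inj₁ refl = refl
  ... | inj₁ refl | inj₂ refl = refl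
  ... | inj₂ refl | inj₁ refl = refl
  ... | inj₂ refl | inj₂ refl = refl

  inner : ∀ {c b} → c ≢ 0# → b ≢ 0# → b ∈ c · b · c ⊞ b
  inner c≢0 b≢0 with ≢0⇒±1 c≢0 | ≢0⇒±1 b≢0
  ... | inj₁ refl | inj₁ refl = refl
  ... | inj₁ refl | inj₂ refl = refl
  ... | inj₂ refl | inj₁ refl = refl
  ... | inj₂ refl | inj₂ refl = refl

  p-suc : ∀ i → coeff p (suc i) ∈
          (c · b) · coeffs (b ∷ c ∷ []) (suc i) ⊞ coeffs (b ∷ c ∷ []) i
  p-suc zero    = inner (proj₁ dp) p1≢0
  p-suc (suc zero)    rewrite ·-zeroʳ (c · b) = refl
  p-suc (suc (suc i)) rewrite ·-zeroʳ (c · b) = sym (proj₂ dp (3 + i) (s≤s (s≤s (s≤s z≤n))))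

-- Identification with the listed polynomials up to sign

degree-1-≈ : ∀ p q → HasDegree p 1 → HasDegree q 1 →
  coeff p 0 ≡ coeff q 0 → coeff p 1 ≡ coeff q 1 → p ≈ q
degree-1-≈ p q _        _        p0 _  zero          = p0
degree-1-≈ p q _        _        _  p1 (suc zero)    = p1
degree-1-≈ p q (_ , p>) (_ , q>) _  _  (suc (suc i)) =
  trans (p> _ (s≤s (s≤s z≤n))) (sym (q> _ (s≤s (s≤s z≤n))))

degree-2-≈ : ∀ p q → HasDegree p 2 → HasDegree q 2 →
  coeff p 0 ≡ coeff q 0 → coeff p 1 ≡ coeff q 1 → coeff p 2 ≡ coeff q 2 → p ≈ q
degree-2-≈ p q _        _        p0 _  _  zero                = p0
degree-2-≈ p q _        _        _  p1 _  (suc zero)          = p1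
degree-2-≈ p q _        _        _  _  p2 (suc (suc zero))    = p2
degree-2-≈ p q (_ , p>) (_ , q>) _  _  _  (suc (suc (suc i))) =
  trans (p> _ (s≤s (s≤s (s≤s z≤n)))) (sym (q> _ (s≤s (s≤s (s≤s z≤n)))))

linear-degree : ∀ a → HasDegree (linear a) 1
linear-degree a = (λ ()) , coeffs-vanish (a ∷ 1# ∷ [])

-ᵖ-degree : ∀ p {n} → HasDegree p n → HasDegree (-ᵖ p) n
-ᵖ-degree p (pn , p>) = -‿nonzero pn , λ i n<i → cong -_ (p> i n<i)

±Listed : Poly → Set
±Listed p = Any (λ f → p ≈ f ⊎ p ≈ -ᵖ f) (T ∷ T-1 ∷ T+1 ∷ T²+1 ∷ [])

classify-linear : ∀ p → HasDegree p 1 → ±Listed p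
classify-linear p dp = go (coeff p 0) (coeff p 1) refl refl
  where
  plus : ∀ a → coeff p 0 ≡ a → coeff p 1 ≡ 1# → p ≈ linear a
  plus a = degree-1-≈ p (linear a) dp (linear-degree a)

  minus : ∀ a → coeff p 0 ≡ - a → coeff p 1 ≡ -1# → p ≈ -ᵖ linear a
  minus a = degree-1-≈ p (-ᵖ linear a) dp (-ᵖ-degree (linear a) (linear-degree a))

  go : ∀ c₀ c₁ → coeff p 0 ≡ c₀ → coeff p 1 ≡ c₁ → ±Listed p
  go _   0#  _  p1 = contradiction p1 (proj₁ dp)
  go 0#  1#  p0 p1 = here (inj₁ (plus 0# p0 p1))
  go -1# 1#  p0 p1 = there (here (inj₁ (plus -1# p0 p1)))
  go 1#  1#  p0 p1 = there (there (here (inj₁ (plus 1# p0 p1))))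
  go 0#  -1# p0 p1 = here (inj₂ (minus 0# p0 p1))
  -- Negation flips the constant term too: `1 - T` is the negative of `T-1`.
  go 1#  -1# p0 p1 = there (here (inj₂ (minus -1# p0 p1)))
  go -1# -1# p0 p1 = there (there (here (inj₂ (minus 1# p0 p1))))

classify-biquadratic : ∀ p → HasDegree p 2 → coeff p 1 ≡ 0# →
                       coeff p 2 ≡ coeff p 0 → ±Listed p
classify-biquadratic p dp p1≡0 p2≡p0 with ≢0⇒±1 (proj₁ dp)
... | inj₁ p2≡1  = there (there (there (here (inj₁
  (degree-2-≈ p T²+1 dp T²+1-degree (trans (sym p2≡p0) p2≡1) p1≡0 p2≡1)))))
... | inj₂ p2≡-1 = there (there (there (here (inj₂
  (degree-2-≈ p (-ᵖ T²+1) dp (-ᵖ-degree T²+1 T²+1-degree)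
    (trans (sym p2≡p0) p2≡-1) p1≡0 p2≡-1)))))

-- Beyond degree 1, a zero constant term, opposite ends, equal ends in degree at least 3, and a
-- nonzero middle term in degree 2 each give a proper factorization. What survives is a sign times
-- `T²+1`.
classify : ∀ p → Irreducible p → ±Listed p
classify p ((suc zero , dp , _) , _) = classify-linear p dp
classify p irr@((suc (suc m) , dp , _) , _) with coeff p 0 ≟0#
... | yes p0≡0 = contradiction irr (zero-constant-reducible p dp p0≡0)
... | no p0≢0 with equal-or-opposite (proj₁ dp) p0≢0
...   | inj₂ opposite = contradiction irr (opposite-ends-reducible p dp opposite)
classify p irr@((suc (suc (suc m)) , dp , _) , _) | no p0≢0 | inj₁ equal =
  contradiction irr (equal-ends-reducible p dp p0≢0 equal)
classify p irr@((suc (suc zero) , dp , _) , _) | no _ | inj₁ equal with coeff p 1 ≟0#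
... | yes p1≡0 = classify-biquadratic p dp p1≡0 equal
... | no p1≢0  = contradiction irr (palindromic-quadratic-reducible p dp p1≢0 equal)

-- Uniqueness of the degree places the leading coefficient of `p` at `n`, where it is `-1#`.
opposite-not-monic : ∀ {p f n} → HasDegree f n → coeff f n ≡ 1# → p ≈ -ᵖ f → ¬ Monic p
opposite-not-monic {p} {f} df fn≡1 p≈-f (m , dp , pm≡1)
  with HasDegree-unique {p} dp (HasDegree-resp-≈ {p} { -ᵖ f} p≈-f (-ᵖ-degree f df))
... | refl = contradiction (trans (sym pm≡1) (trans (p≈-f m) (cong -_ fn≡1))) λ ()

listed-monic : ∀ p → Monic p → ±Listed p → p ≈ T ⊎ p ≈ T-1 ⊎ p ≈ T+1 ⊎ p ≈ T²+1
listed-monic p mon (here (inj₁ p≈)) = inj₁ p≈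
listed-monic p mon (here (inj₂ p≈)) =
  contradiction mon (opposite-not-monic {p} {T} (linear-degree 0#) refl p≈)
listed-monic p mon (there (here (inj₁ p≈))) = inj₂ (inj₁ p≈)
listed-monic p mon (there (here (inj₂ p≈))) =
  contradiction mon (opposite-not-monic {p} {T-1} (linear-degree -1#) refl p≈)
listed-monic p mon (there (there (here (inj₁ p≈)))) = inj₂ (inj₂ (inj₁ p≈))
listed-monic p mon (there (there (here (inj₂ p≈)))) =
  contradiction mon (opposite-not-monic {p} {T+1} (linear-degree 1#) refl p≈)
listed-monic p mon (there (there (there (here (inj₁ p≈))))) = inj₂ (inj₂ (inj₂ p≈))
listed-monic p mon (there (there (there (here (inj₂ p≈))))) =
  contradiction mon (opposite-not-monic {p} {T²+1} T²+1-degree refl p≈)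

≈linear⇒monic-irreducible : ∀ p a → p ≈ linear a → Monic p × Irreducible p
≈linear⇒monic-irreducible p a p≈ = (1 , dp , p≈ 1) , degree-1-irreducible p dp
  where
  dp : HasDegree p 1
  dp = HasDegree-resp-≈ {p} {linear a} p≈ (linear-degree a)

≈T²+1⇒monic-irreducible : ∀ p → p ≈ T²+1 → Monic p × Irreducible p
≈T²+1⇒monic-irreducible p p≈ =
  (2 , HasDegree-resp-≈ {p} {T²+1} p≈ T²+1-degree , p≈ 2) , ≈T²+1-irreducible p p≈

mainTheorem9 : (∀ p → (Monic p × Irreducible p) ⇔ (p ≈ T ⊎ p ≈ T-1 ⊎ p ≈ T+1 ⊎ p ≈ T²+1))
    × (∀ p → Irreducible p →
    Any (λ f → p ≈ f ⊎ p ≈ -ᵖ f) (T ∷ T-1 ∷ T+1 ∷ T²+1 ∷ []))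
mainTheorem9 = (λ p → mk⇔ (λ (mon , irr) → listed-monic p mon (classify p irr)) (listed⇒ p)) , classify
  where
  listed⇒ : ∀ p → p ≈ T ⊎ p ≈ T-1 ⊎ p ≈ T+1 ⊎ p ≈ T²+1 → Monic p × Irreducible p
  listed⇒ p (inj₁ p≈)               = ≈linear⇒monic-irreducible p 0# p≈
  listed⇒ p (inj₂ (inj₁ p≈))        = ≈linear⇒monic-irreducible p -1# p≈
  listed⇒ p (inj₂ (inj₂ (inj₁ p≈))) = ≈linear⇒monic-irreducible p 1# p≈
  listed⇒ p (inj₂ (inj₂ (inj₂ p≈))) = ≈T²+1⇒monic-irreducible p p≈
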